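{- For every $n\in\mathbb{N}$, all nonempty chains $c_k,c_s$ over $[n]$, and all formulas $\varphi,\psi$: letting $c_r$ be the chain of symbols common to $c_k$ and $c_s$, $$\vdash_{(n)}\neg_{c_k}\varphi\to_{(n)}\big(\neg_{c_s}\psi\to_{(n)}\neg_{c_s\otimes c_r}(\varphi\to_{(n)}\psi)\big).$$
   Context: Fix $n\in\mathbb{N}$, $n\ge 1$, and write $[n]=\{1,\dots,n\}$. Chains: a chain over $[n]$ is a finite sequence of distinct elements of $[n]$; chains with the same length and the same symbols are identified, so a chain is effectively a subset of $[n]$. $c_k$ denotes a chain with $k$ symbols, $\epsilon$ the empty chain, and $(n)$ the chain consisting of all symbols of $[n]$. For chains $c,d$: the concatenation $c\cdot d$ is the chain of symbols occurring in $c$ or in $d$; the coconcatenation $c\otimes d$ is the chain of symbols occurring in exactly one of $c,d$; $d$ is a subchain of $c$ if every symbol of $d$ is a symbol of $c$. The complementary chain $c'_{n-k}$ of $c_k$ is the chain of the symbols of $[n]$ not occurring in $c_k$. Language of $\mathbf{CPN}_n$: a countable set $P_n$ of propositional letters; constants $\perp_c$ for each chain $c$ over $[n]$ with $1\le |c|\le n-1$, and constants $\perp_{(n)}$ (contradiction) and $\top_{(n)}$ (truth); a unary connective $\neg_c$ for each nonempty chain $c$ over $[n]$ ($\neg_{(n)}$ is the strong negation; the $\neg_c$ with $|c|\le n-1$ are weak negations); a binary connective $\to_{(n)}$. Formulas: propositional letters and constants are formulas; if $\varphi,\psi$ are formulas then so are $\neg_c\varphi$ and $(\varphi\to_{(n)}\psi)$.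 Conventions: $\neg_\epsilon\varphi:=\varphi$, $\perp_\epsilon:=\top_{(n)}$, and $\perp_c$ for $c=(n)$ means $\perp_{(n)}$. Abbreviations: $\varphi\wedge_{(n)}\psi:=\neg_{(n)}(\varphi\to_{(n)}\neg_{(n)}\psi)$, $\varphi\vee_{(n)}\psi:=\neg_{(n)}\varphi\to_{(n)}\psi$, $\varphi\leftrightarrow_{(n)}\psi:=(\varphi\to_{(n)}\psi)\wedge_{(n)}(\psi\to_{(n)}\varphi)$. Axioms of $\mathbf{CPN}_n$, for all formulas $\varphi,\psi,\chi$ and all nonempty chains $c_k,c_r$ over $[n]$: (A1) $\varphi\to_{(n)}(\psi\to_{(n)}\varphi)$; (A2) $(\varphi\to_{(n)}(\psi\to_{(n)}\chi))\to_{(n)}((\varphi\to_{(n)}\psi)\to_{(n)}(\varphi\to_{(n)}\chi))$; (A3) $(\neg_{(n)}\psi\to_{(n)}\neg_{(n)}\varphi)\to_{(n)}((\neg_{(n)}\psi\to_{(n)}\varphi)\to_{(n)}\psi)$; (A4) $\varphi\to_{(n)}(\perp_{c_k}\to_{(n)}\neg_{c_k}\varphi)$; (A5) $\neg_{c_k}\neg_{c_r}\varphi\leftrightarrow_{(n)}\neg_{c_k\otimes c_r}\varphi$; (A6) $\neg_{c_k}\perp_{c_r}\leftrightarrow_{(n)}\perp_{c_k\otimes c_r}$; (A7) $\perp_{c_k}\to_{(n)}\perp_{c_r}$, whenever $c_r$ is a subchain of $c_k$. The only rule of inference is modus ponens (from $\varphi$ and $\varphi\to_{(n)}\psi$ infer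 $\psi$). For a set $\Sigma$ of formulas, $\Sigma\vdash_{(n)}\varphi$ means there is a finite sequence of formulas ending with $\varphi$, each of which is an axiom, a member of $\Sigma$, or obtained from two earlier members by modus ponens; $\vdash_{(n)}\varphi$ means $\emptyset\vdash_{(n)}\varphi$. -}

module Defs where

open import Data.Bool using (_xor_)
open import Data.Fin.Subset using (Subset; Nonempty; _⊆_) renaming (⊤ to full)
open import Data.Fin.Subset.Properties using (nonempty?)
open import Data.List using (List; []; _∷_)
open import Data.List.Membership.Propositional using (_∈_)
open import Data.Nat using (ℕ)
open import Data.Product using (∃-syntax)
open import Data.Vec using (zipWith)
open import Level using (0ℓ)
open import Relation.Nullary using (yes; no)
open import Relation.Unary using (Pred; ∅) renaming (_∈_ to _∈ₛ_)

-- Chains with the same symbols are identified, so a chain over [n] is a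
-- subset of Fin n; the chain (n) is `full`.
Chain : ℕ → Set
Chain = Subset

infixr 6 _⊗_

_⊗_ : ∀ {n} → Chain n → Chain n → Chain n
_⊗_ = zipWith _xor_

infix  8 ¬[_]_ ~_
infixr 7 _∧_
infixr 5 _⇒_
infix  4 _⇔_

-- The nonemptiness proofs are irrelevant, so there is exactly one constant
-- and one negation for each nonempty chain.  `bot` covers both the ⊥_c with
-- 1 ≤ |c| ≤ n-1 and, at `full`, the contradiction ⊥_(n); likewise `neg` at
-- `full` is the strong negation.
data Formula (n : ℕ) (P : Set) : Set where
  letter : P → Formula n P
  bot    : (c : Chain n) → .(Nonempty c) → Formula n P
  top    : Formula n P
  neg    : (c : Chain n) → .(Nonempty c) → Formula n P → Formula n P
  _⇒_    : Formula n P → Formula n P → Formula n P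

-- ⊥_c and ¬_c for an arbitrary chain, with the conventions ⊥_ε := ⊤_(n) and
-- ¬_ε φ := φ.
⊥[_] : ∀ {n P} → Chain n → Formula n P
⊥[ c ] with nonempty? c
... | yes ne = bot c ne
... | no  _  = top

¬[_]_ : ∀ {n P} → Chain n → Formula n P → Formula n P
¬[ c ] φ with nonempty? c
... | yes ne = neg c ne φ
... | no  _  = φ

~_ : ∀ {n P} → Formula n P → Formula n P
~ φ = ¬[ full ] φ

_∧_ : ∀ {n P} → Formula n P → Formula n P → Formula n P
φ ∧ ψ = ~ (φ ⇒ ~ ψ)

_⇔_ : ∀ {n P} → Formula n P → Formula n P → Formula n P
φ ⇔ ψ = (φ ⇒ ψ) ∧ (ψ ⇒ φ)

data Axiom {n : ℕ} {P : Set} : Formula n P → Set where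
  A1 : ∀ φ ψ → Axiom (φ ⇒ (ψ ⇒ φ))
  A2 : ∀ φ ψ χ → Axiom ((φ ⇒ (ψ ⇒ χ)) ⇒ ((φ ⇒ ψ) ⇒ (φ ⇒ χ)))
  A3 : ∀ φ ψ → Axiom ((~ ψ ⇒ ~ φ) ⇒ ((~ ψ ⇒ φ) ⇒ ψ))
  A4 : ∀ k → Nonempty k → ∀ φ → Axiom (φ ⇒ (⊥[ k ] ⇒ ¬[ k ] φ))
  A5 : ∀ k r → Nonempty k → Nonempty r → ∀ φ →
       Axiom (¬[ k ] ¬[ r ] φ ⇔ ¬[ k ⊗ r ] φ)
  A6 : ∀ k r → Nonempty k → Nonempty r →
       Axiom (¬[ k ] ⊥[ r ] ⇔ ⊥[ k ⊗ r ])
  A7 : ∀ k r → Nonempty k → Nonempty r → r ⊆ k →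
       Axiom (⊥[ k ] ⇒ ⊥[ r ])

module _ {n : ℕ} {P : Set} (Σ : Pred (Formula n P) 0ℓ) where

  data Justified (earlier : List (Formula n P)) (φ : Formula n P) : Set where
    axiom      : Axiom φ → Justified earlier φ
    assumption : φ ∈ₛ Σ → Justified earlier φ
    mp         : ∀ ψ → ψ ∈ earlier → (ψ ⇒ φ) ∈ earlier → Justified earlier φ

  -- The sequence is listed in reverse: its last formula is the head.
  data IsDerivation : List (Formula n P) → Set where
    []  : IsDerivation []
    _∷_ : ∀ {φ φs} → Justified φs φ → IsDerivation φs → IsDerivation (φ ∷ φs)

infix 3 _⊢_ ⊢_

_⊢_ : ∀ {n P} → Pred (Formula n P) 0ℓ → Formula n P → Set
Σ ⊢ φ = ∃[ φs ] IsDerivation Σ (φ ∷ φs)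

⊢_ : ∀ {n P} → Formula n P → Set
⊢ φ = ∅ ⊢ φ

{-# OPTIONS --safe #-}

-- A4 and A5 determine ¬_c by cases on ⊥_c: under ⊥_c it is the identity, and
-- under ~ ⊥_c, which amounts to ⊥ of the complement of c, it is the strong
-- negation.  A classical case split on ⊥_k and ⊥_s then settles the claim: with
-- d = s ⊗ (k ∩ s) = s \ k, A7 decides ⊥_d in each case, except that ⊥_k and
-- ~ ⊥_s refute ⊥_d because ⊥_k and ⊥_d together give ⊥_(k ∪ s).

module Submission where

open import Defs
open import Data.Bool using (true; false; _xor_) renaming (_∧_ to _and_)
open import Data.Bool.Properties using (xor-assoc; xor-comm; xor-identityˡ; xor-identityʳ; xor-same)
open import Data.Empty using (⊥-elim)
open import Data.Fin.Subset using (Nonempty; _∩_; _⊆_) renaming (⊤ to full; ⊥ to ε)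
open import Data.Fin.Subset.Properties using (nonempty?; Empty-unique; ∉⊥; ∈⊤)
open import Data.List using (List; []; _∷_; _++_)
open import Data.List.Membership.Propositional using (_∈_)
open import Data.List.Membership.Propositional.Properties using (∈-++⁺ˡ; ∈-++⁺ʳ)
open import Data.List.Relation.Unary.Any using (here; there)
open import Data.Nat using (ℕ; NonZero)
open import Data.Product using (_,_)
open import Data.Sum using (_⊎_; inj₁; inj₂)
open import Data.Vec using ([]; _∷_; lookup)
open import Data.Vec.Properties
  using (zipWith-assoc; zipWith-comm; zipWith-identityˡ; zipWith-identityʳ;
         lookup-zipWith; lookup-replicate; []=⇒lookup; lookup⇒[]=)
open import Function.Bundles using (_↣_)
open import Level using (0ℓ)
open import Relation.Binary.PropositionalEquality
  using (_≡_; refl; sym; trans; cong; cong₂; subst)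
open import Relation.Nullary using (yes; no)
open import Relation.Unary using (Pred)

-- Symmetric differences and inclusions of chains.

⊗-identityˡ : ∀ {n} (c : Chain n) → ε ⊗ c ≡ c
⊗-identityˡ = zipWith-identityˡ xor-identityˡ

⊗-identityʳ : ∀ {n} (c : Chain n) → c ⊗ ε ≡ c
⊗-identityʳ = zipWith-identityʳ xor-identityʳ

⊗-self : ∀ {n} (c : Chain n) → c ⊗ c ≡ ε
⊗-self []      = refl
⊗-self (x ∷ c) = cong₂ _∷_ (xor-same x) (⊗-self c)

⊗-cancelʳ : ∀ {n} (a c : Chain n) → (a ⊗ c) ⊗ c ≡ a
⊗-cancelʳ a c = trans (zipWith-assoc xor-assoc a c c)
                      (trans (cong (a ⊗_) (⊗-self c)) (⊗-identityʳ a))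

⊗-cancelˡ : ∀ {n} (a c : Chain n) → (a ⊗ c) ⊗ a ≡ c
⊗-cancelˡ a c = trans (cong (_⊗ a) (zipWith-comm xor-comm a c)) (⊗-cancelʳ c a)

empty⊎nonempty : ∀ {n} (c : Chain n) → c ≡ ε ⊎ Nonempty c
empty⊎nonempty c with nonempty? c
... | yes ne = inj₂ ne
... | no  e  = inj₁ (Empty-unique e)

⊆-pointwise : ∀ {n} {p q : Chain n} →
  (∀ x → lookup p x ≡ true → lookup q x ≡ true) → p ⊆ q
⊆-pointwise {q = q} f {x} x∈p = lookup⇒[]= x q (f x ([]=⇒lookup x∈p))

lookup-⊗∩ : ∀ {n} (k s : Chain n) x →
  lookup (s ⊗ (k ∩ s)) x ≡ lookup s x xor (lookup k x and lookup s x)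
lookup-⊗∩ k s x = trans (lookup-zipWith _xor_ x s (k ∩ s))
                        (cong (lookup s x xor_) (lookup-zipWith _and_ x k s))

⊗∩-⊆ : ∀ {n} (k s : Chain n) → s ⊗ (k ∩ s) ⊆ s
⊗∩-⊆ k s = ⊆-pointwise λ x eq →
  bool (lookup k x) (lookup s x) (trans (sym (lookup-⊗∩ k s x)) eq)
  where
  bool : ∀ a b → b xor (a and b) ≡ true → b ≡ true
  bool _     true  _  = refl
  bool true  false ()
  bool false false ()

⊗∩-⊆-complement : ∀ {n} (k s : Chain n) → s ⊗ (k ∩ s) ⊆ full ⊗ k
⊗∩-⊆-complement {n} k s = ⊆-pointwise λ x eq →
  trans (trans (lookup-zipWith _xor_ x full k)
               (cong (_xor lookup k x) (lookup-replicate x true)))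
        (bool (lookup k x) (lookup s x) (trans (sym (lookup-⊗∩ k s x)) eq))
  where
  bool : ∀ a b → b xor (a and b) ≡ true → true xor a ≡ true
  bool false _     _  = refl
  bool true  true  ()
  bool true  false ()

-- The chains `k` and `s ⊗ (k ∩ s)` are disjoint, so their coconcatenation is the union of `k` and
-- `s`.
⊆-⊗-⊗∩ : ∀ {n} (k s : Chain n) → s ⊆ k ⊗ (s ⊗ (k ∩ s))
⊆-⊗-⊗∩ k s = ⊆-pointwise λ x eq →
  trans (trans (lookup-zipWith _xor_ x k (s ⊗ (k ∩ s)))
               (cong (lookup k x xor_) (lookup-⊗∩ k s x)))
        (bool (lookup k x) (lookup s x) eq)
  where
  bool : ∀ a b → b ≡ true → a xor (b xor (a and b)) ≡ true
  bool true  true _ = refl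
  bool false true _ = refl

⊥[ε]≡top : ∀ n {P} → ⊥[_] {n} {P} ε ≡ top
⊥[ε]≡top n with nonempty? {n} ε
... | yes (_ , x∈ε) = ⊥-elim (∉⊥ x∈ε)
... | no  _         = refl

¬[ε]≡ : ∀ {n P} (φ : Formula n P) → ¬[ ε ] φ ≡ φ
¬[ε]≡ {n} φ with nonempty? {n} ε
... | yes (_ , x∈ε) = ⊥-elim (∉⊥ x∈ε)
... | no  _         = refl

-- Derivation trees and their linearization.

infix 3 _⊩_

-- Trees over a list of hypotheses make the deduction theorem a structural induction; only closed
-- trees are turned back into sequences.
data _⊩_ {n P} (Γ : List (Formula n P)) : Formula n P → Set where
  ax  : ∀ {φ} → Axiom φ → Γ ⊩ φ
  hyp : ∀ {φ} → φ ∈ Γ → Γ ⊩ φ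
  app : ∀ {φ ψ} → Γ ⊩ φ ⇒ ψ → Γ ⊩ φ → Γ ⊩ ψ

module _ {n : ℕ} {P : Set} (Σ : Pred (Formula n P) 0ℓ) where

  Justified-mono : ∀ {xs ys φ} → (∀ {ψ} → ψ ∈ xs → ψ ∈ ys) →
    Justified Σ xs φ → Justified Σ ys φ
  Justified-mono f (axiom a)      = axiom a
  Justified-mono f (assumption a) = assumption a
  Justified-mono f (mp ψ i j)     = mp ψ (f i) (f j)

  IsDerivation-++ : ∀ {xs ys} →
    IsDerivation Σ xs → IsDerivation Σ ys → IsDerivation Σ (xs ++ ys)
  IsDerivation-++ []      e = e
  IsDerivation-++ (j ∷ d) e = Justified-mono ∈-++⁺ˡ j ∷ IsDerivation-++ d e

  ⊩⇒⊢ : ∀ {φ} → [] ⊩ φ → Σ ⊢ φ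
  ⊩⇒⊢ (ax a) = [] , axiom a ∷ []
  ⊩⇒⊢ (app {φ} p q) with ⊩⇒⊢ p | ⊩⇒⊢ q
  ... | ps , dp | qs , dq =
    -- Sequences are reversed: the head of the first block is the implication, and the head of the
    -- second is its antecedent `φ`.
    _ , mp φ (∈-++⁺ʳ (_ ∷ ps) (here refl)) (here refl) ∷ IsDerivation-++ dp dq

-- Classical reasoning with strong negation.

module _ {n : ℕ} {P : Set} where

  private variable
    Γ     : List (Formula n P)
    φ ψ χ : Formula n P

  weaken : Γ ⊩ φ → ψ ∷ Γ ⊩ φ
  weaken (ax a)    = ax a
  weaken (hyp i)   = hyp (there i)
  weaken (app p q) = app (weaken p) (weaken q)

  hyp₀ : φ ∷ Γ ⊩ φ
  hyp₀ = hyp (here refl)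

  const : ∀ φ → Γ ⊩ ψ → Γ ⊩ φ ⇒ ψ
  const φ p = app (ax (A1 _ φ)) p

  -- The deduction theorem: A2 distributes the hypothesis over modus ponens, and the hypothesis
  -- itself becomes the identity implication S K K.
  ⇒-intro : φ ∷ Γ ⊩ ψ → Γ ⊩ φ ⇒ ψ
  ⇒-intro {φ} (ax a)            = const φ (ax a)
  ⇒-intro {φ} (hyp (here refl)) =
    app (app (ax (A2 φ (φ ⇒ φ) φ)) (ax (A1 φ (φ ⇒ φ)))) (ax (A1 φ φ))
  ⇒-intro {φ} (hyp (there i))   = const φ (hyp i)
  ⇒-intro     (app p q)         = app (app (ax (A2 _ _ _)) (⇒-intro p)) (⇒-intro q)

  by-contradiction : ∀ φ ψ → ~ ψ ∷ Γ ⊩ φ → ~ ψ ∷ Γ ⊩ ~ φ → Γ ⊩ ψ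
  by-contradiction φ ψ p q = app (app (ax (A3 φ ψ)) (⇒-intro q)) (⇒-intro p)

  explode : ∀ φ ψ → Γ ⊩ φ → Γ ⊩ ~ φ → Γ ⊩ ψ
  explode φ ψ p q = by-contradiction φ ψ (weaken p) (weaken q)

  ~~-elim : ∀ φ → Γ ⊩ ~ ~ φ → Γ ⊩ φ
  ~~-elim φ p = by-contradiction (~ φ) φ hyp₀ (weaken p)

  ~-intro : ∀ φ ψ → φ ∷ Γ ⊩ ψ → φ ∷ Γ ⊩ ~ ψ → Γ ⊩ ~ φ
  ~-intro φ ψ p q = by-contradiction ψ (~ φ) (cut p) (cut q)
    where
    -- A3 discharges only strongly negated hypotheses, here `~ ~ φ`, so `φ` is first recovered from
    -- it.
    cut : φ ∷ Γ ⊩ χ → ~ ~ φ ∷ Γ ⊩ χ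
    cut r = app (weaken (⇒-intro r)) (~~-elim φ hyp₀)

  cases : ∀ φ ψ → φ ∷ Γ ⊩ ψ → ~ φ ∷ Γ ⊩ ψ → Γ ⊩ ψ
  cases φ ψ p q = by-contradiction φ ψ
    (by-contradiction ψ φ (app (weaken (weaken (⇒-intro q))) hyp₀) (weaken hyp₀))
    (~-intro φ ψ (app (weaken (weaken (⇒-intro p))) hyp₀) (weaken hyp₀))

  ∧-elimˡ : ∀ φ ψ → Γ ⊩ φ ∧ ψ → Γ ⊩ φ
  ∧-elimˡ φ ψ p = by-contradiction (φ ⇒ ~ ψ) φ
    -- Under `~ φ` the implication `φ ⇒ ~ ψ` holds vacuously, while the conjunction is its negation.
    (⇒-intro (explode φ (~ ψ) hyp₀ (weaken hyp₀))) (weaken p)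

  ⇔-elimˡ : ∀ φ ψ → Γ ⊩ φ ⇔ ψ → Γ ⊩ φ → Γ ⊩ ψ
  ⇔-elimˡ φ ψ p = app (∧-elimˡ (φ ⇒ ψ) (ψ ⇒ φ) p)

  -- Weak negations and their constants.

  ¬-intro : ∀ k φ → Γ ⊩ ⊥[ k ] → Γ ⊩ φ → Γ ⊩ ¬[ k ] φ
  ¬-intro {Γ} k φ b p with empty⊎nonempty k
  ... | inj₁ refl = subst (Γ ⊩_) (sym (¬[ε]≡ φ)) p
  ... | inj₂ ne   = app (app (ax (A4 k ne φ)) p) b

  ¬-merge : ∀ k r φ → Γ ⊩ ¬[ k ] ¬[ r ] φ → Γ ⊩ ¬[ k ⊗ r ] φ
  ¬-merge {Γ} k r φ p with empty⊎nonempty k | empty⊎nonempty r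
  ... | inj₁ refl | _ rewrite ⊗-identityˡ r = subst (Γ ⊩_) (¬[ε]≡ (¬[ r ] φ)) p
  ... | inj₂ _ | inj₁ refl rewrite ⊗-identityʳ k =
    subst (λ χ → Γ ⊩ ¬[ k ] χ) (¬[ε]≡ φ) p
  ... | inj₂ k≠ε | inj₂ r≠ε = ⇔-elimˡ _ _ (ax (A5 k r k≠ε r≠ε φ)) p

  -- A4 prefixes a second `¬[ k ]`, and A5 cancels the two because `k ⊗ k` is empty.
  ¬-elim : ∀ k φ → Γ ⊩ ⊥[ k ] → Γ ⊩ ¬[ k ] φ → Γ ⊩ φ
  ¬-elim {Γ} k φ b p =
    subst (Γ ⊩_) (trans (cong (λ c → ¬[ c ] φ) (⊗-self k)) (¬[ε]≡ φ))
          (¬-merge k k φ (¬-intro k (¬[ k ] φ) b p))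

  -- A4 applied to the formula `⊥[ r ]` gives the left side of A6.
  ⊥-⊗ : ∀ k r → Γ ⊩ ⊥[ k ] → Γ ⊩ ⊥[ r ] → Γ ⊩ ⊥[ k ⊗ r ]
  ⊥-⊗ k r p q with empty⊎nonempty k | empty⊎nonempty r
  ... | inj₁ refl | _ rewrite ⊗-identityˡ r = q
  ... | inj₂ _ | inj₁ refl rewrite ⊗-identityʳ k = p
  ... | inj₂ k≠ε | inj₂ r≠ε =
    ⇔-elimˡ (¬[ k ] ⊥[ r ]) _ (ax (A6 k r k≠ε r≠ε)) (¬-intro k ⊥[ r ] p q)

  module _ (full≠ε : Nonempty {n} full) where

    -- No axiom asserts truth outright, so it is reached through A6 as `⊥[ full ⊗ full ]`. This
    -- needs `~ ⊥[ full ]`, which holds because by A4 `⊥[ full ]` would strongly negate a theorem.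
    ⊥[ε]-intro : Γ ⊩ ⊥[ ε ]
    ⊥[ε]-intro {Γ} = subst (λ c → Γ ⊩ ⊥[ c ]) (⊗-self full)
      (⇔-elimˡ (~ ⊥[ full ]) _ (ax (A6 full full full≠ε full≠ε))
        (~-intro ⊥[ full ] theorem (ax (A1 top top))
          (¬-intro full theorem hyp₀ (ax (A1 top top)))))
      where
      theorem = top ⇒ (top ⇒ top)

    ⊥-⊆ : ∀ k r → r ⊆ k → Γ ⊩ ⊥[ k ] → Γ ⊩ ⊥[ r ]
    ⊥-⊆ k r r⊆k p with empty⊎nonempty r
    ... | inj₁ refl      = ⊥[ε]-intro
    ... | inj₂ (x , x∈r) = app (ax (A7 k r (x , r⊆k x∈r) (x , x∈r) r⊆k)) p

    ~⊥⇒⊥-complement : ∀ k → Γ ⊩ ~ ⊥[ k ] → Γ ⊩ ⊥[ full ⊗ k ]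
    ~⊥⇒⊥-complement k p with empty⊎nonempty k
    ... | inj₁ refl = explode ⊥[ ε ] ⊥[ full ⊗ ε ] ⊥[ε]-intro p
    ... | inj₂ ne   = ⇔-elimˡ (~ ⊥[ k ]) _ (ax (A6 full k full≠ε ne)) p

    -- The complement of `k` has its constant available, so A4 prefixes its negation; merged with
    -- `¬[ k ]`, this is the negation of the full chain.
    ¬⇒~ : ∀ k φ → Γ ⊩ ~ ⊥[ k ] → Γ ⊩ ¬[ k ] φ → Γ ⊩ ~ φ
    ¬⇒~ {Γ} k φ b p = subst (λ c → Γ ⊩ ¬[ c ] φ) (⊗-cancelʳ full k)
      (¬-merge (full ⊗ k) k φ
        (¬-intro (full ⊗ k) (¬[ k ] φ) (~⊥⇒⊥-complement k b) p))

    -- As before, but the negation of the complement merges with the strong one, leaving `¬[ k ]`.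
    ~⇒¬ : ∀ k φ → Γ ⊩ ~ ⊥[ k ] → Γ ⊩ ~ φ → Γ ⊩ ¬[ k ] φ
    ~⇒¬ {Γ} k φ b p = subst (λ c → Γ ⊩ ¬[ c ] φ) (⊗-cancelˡ full k)
      (¬-merge (full ⊗ k) full φ
        (¬-intro (full ⊗ k) (~ φ) (~⊥⇒⊥-complement k b) p))

    ¬-⇒ : ∀ k s φ ψ → Γ ⊩ ¬[ k ] φ → Γ ⊩ ¬[ s ] ψ → Γ ⊩ ¬[ s ⊗ (k ∩ s) ] (φ ⇒ ψ)
    ¬-⇒ k s φ ψ p q = cases ⊥[ k ] goal (cases ⊥[ s ] goal ⊥k⊥s ⊥k~⊥s) ~⊥k
      where
      d    = s ⊗ (k ∩ s)
      goal = ¬[ d ] (φ ⇒ ψ)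

      -- Here `φ` is false, so the implication is vacuous and `¬[ d ]` is the identity.
      ~⊥k : ~ ⊥[ k ] ∷ _ ⊩ goal
      ~⊥k = ¬-intro d (φ ⇒ ψ)
        (⊥-⊆ (full ⊗ k) d (⊗∩-⊆-complement k s) (~⊥⇒⊥-complement k hyp₀))
        (⇒-intro (explode φ ψ hyp₀ (weaken (¬⇒~ k φ hyp₀ (weaken p)))))

      ⊥k⊥s : ⊥[ s ] ∷ ⊥[ k ] ∷ _ ⊩ goal
      ⊥k⊥s = ¬-intro d (φ ⇒ ψ) (⊥-⊆ s d (⊗∩-⊆ k s) hyp₀)
        (const φ (¬-elim s ψ hyp₀ (weaken (weaken q))))

      -- Here `φ` holds and `ψ` fails, so the implication is false, and `¬[ d ]` is the strong
      -- negation.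
      ⊥k~⊥s : ~ ⊥[ s ] ∷ ⊥[ k ] ∷ _ ⊩ goal
      ⊥k~⊥s = ~⇒¬ d (φ ⇒ ψ)
        (~-intro ⊥[ d ] ⊥[ s ]
          (⊥-⊆ (k ⊗ d) s (⊆-⊗-⊗∩ k s) (⊥-⊗ k d (weaken (weaken hyp₀)) hyp₀))
          (weaken hyp₀))
        (~-intro (φ ⇒ ψ) ψ
          (app hyp₀ (weaken (¬-elim k φ (weaken hyp₀) (weaken (weaken p)))))
          (weaken (¬⇒~ s ψ hyp₀ (weaken (weaken q)))))

mainTheorem7 : (n : ℕ) .{{_ : NonZero n}} (P : Set) → P ↣ ℕ →
    (k s : Chain n) → Nonempty k → Nonempty s → (φ ψ : Formula n P) →
    ⊢ ¬[ k ] φ ⇒ (¬[ s ] ψ ⇒ ¬[ s ⊗ (k ∩ s) ] (φ ⇒ ψ))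
mainTheorem7 n P _ k s (x , _) _ φ ψ =
  -- The element `x` of `k` also witnesses that `full` is nonempty.
  ⊩⇒⊢ _ (⇒-intro (⇒-intro (¬-⇒ (x , ∈⊤) k s φ ψ (weaken hyp₀) hyp₀)))
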